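{- Let $I$ be a set, and $\mathcal{F}$ a filter on $I$. Then the following conditions are equivalent. (a) For every partition of $I$ into infinitely many subsets $J_s$ ($s\in S$, $S$ an infinite set), there is at least one $s\in S$ such that $I-J_s\in\mathcal{F}$. (b) For every partition of $I$ into a countably infinite family of subsets $J_m$ ($m\in\omega$), there is at least one $m\in\omega$ such that $I-J_m\in\mathcal{F}$. (c) There exists $n\in\omega$ such that for every partition of $I$ into $n+1$ subsets $J_0,\dots,J_n$, there is at least one $m\in\{0,\dots,n\}$ such that $I-J_m\in\mathcal{F}$. (d) $\mathcal{F}$ is the intersection of finitely many ultrafilters on $I$. When these conditions hold, the finite set of ultrafilters having $\mathcal{F}$ as intersection is unique, and its cardinality is the least $n$ as in (c).
   Context: A filter on a set $I$ is a set $\mathcal{F}$ of subsets of $I$ such that $I\in\mathcal{F}$; if $J\in\mathcal{F}$ and $J\subseteq K\subseteq I$ then $K\in\mathcal{F}$; and if $J,K\in\mathcal{F}$ then $J\cap K\in\mathcal{F}$. A filter may be improper (i.e., equal to the set of all subsets of $I$, equivalently contain $\emptyset$). An ultrafilter is a maximal proper filter. Convention: among sets of subsets of $I$, the intersection of the empty family is the set of all subsets of $I$; thus the improper filter is the intersection of the empty (finite) family of ultrafilters. A partition of a set means an expression of it as the union of an indexed family of pairwise disjoint subsets; these subsets are not required to be nonempty (so the empty set may occur one or more times). -}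

module Defs where

open import Data.Fin.Base using (Fin)
open import Data.Nat.Base using (ℕ; suc; _≤_)
open import Data.Product.Base using (∃; Σ-syntax; _×_; proj₁)
open import Function.Bundles using (_⇔_; _⤖_)
open import Function.Definitions using (Injective)
open import Level using (Level) renaming (suc to lsuc; _⊔_ to _⊔ˡ_)
open import Relation.Binary.PropositionalEquality.Core using (_≡_; _≢_)
open import Relation.Nullary.Negation.Core using (¬_)
open import Relation.Unary
  using (Pred; _∈_; _⊆_; _≐_; _∩_; _⊥_; ∁; ⋃; ⋂; Universal)
open import Relation.Unary.Polymorphic using (U)

-- Subsets of I are predicates, compared by extensional equality _≐_.
-- All sets live in one universe level ℓ, and so do the truth values of
-- subsets and of sets of subsets.

Subset : ∀ {ℓ} → Set ℓ → Set (lsuc ℓ)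
Subset {ℓ} I = Pred I ℓ

Family : ∀ {ℓ} → Set ℓ → Set (lsuc ℓ)
Family {ℓ} I = Pred (Subset I) ℓ

-- Closure under supersets makes a filter respect _≐_.

record IsFilter {ℓ} {I : Set ℓ} (F : Family I) : Set (lsuc ℓ) where
  field
    whole  : U ∈ F
    upward : ∀ (J K : Subset I) → J ∈ F → J ⊆ K → K ∈ F
    inter  : ∀ (J K : Subset I) → J ∈ F → K ∈ F → J ∩ K ∈ F

Proper : ∀ {ℓ} {I : Set ℓ} → Family I → Set (lsuc ℓ)
Proper F = ¬ Universal F

record IsUltrafilter {ℓ} {I : Set ℓ} (F : Family I) : Set (lsuc ℓ) where
  field
    isFilter : IsFilter F
    proper   : Proper F
    maximal  : ∀ (G : Family I) → IsFilter G → Proper G → F ⊆ G → G ≐ F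

-- The members J s need not be inhabited, and distinct indices may both
-- carry the empty subset.

record IsPartition {s ℓ} {I : Set ℓ} {S : Set s} (J : S → Subset I)
                   : Set (s ⊔ˡ ℓ) where
  field
    covers   : Universal (⋃ S J)
    disjoint : ∀ (s t : S) → s ≢ t → J s ⊥ J t

Infinite : ∀ {s} → Set s → Set s
Infinite S = ¬ (Σ[ n ∈ ℕ ] (Fin n ⤖ S))

-- Cardinality is counted up to _≐_ on families; `members` also forces 𝒰
-- itself to respect _≐_.

record HasCardinality {ℓ} {I : Set ℓ} (𝒰 : Pred (Family I) (lsuc ℓ)) (n : ℕ)
                      : Set (lsuc ℓ) where
  field
    enum     : Fin n → Family I
    distinct : Injective _≡_ _≐_ enum
    members  : ∀ (G : Family I) → (G ∈ 𝒰) ⇔ (Σ[ i ∈ Fin n ] G ≐ enum i)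

-- For empty 𝒰 the intersection below is the set of all subsets of I.

record IsFiniteUltrafilterDecomposition
         {ℓ} {I : Set ℓ} (F : Family I) (𝒰 : Pred (Family I) (lsuc ℓ))
         : Set (lsuc ℓ) where
  field
    finite        : Σ[ n ∈ ℕ ] HasCardinality 𝒰 n
    ultrafilters  : ∀ (G : Family I) → G ∈ 𝒰 → IsUltrafilter G
    intersection  : F ≐ ⋂ (∃ 𝒰) proj₁

module _ {ℓ} {I : Set ℓ} (F : Family I) where

  SomeComplementIn : ∀ {s} {S : Set s} → (S → Subset I) → Set (s ⊔ˡ ℓ)
  SomeComplementIn {S = S} J = Σ[ s ∈ S ] ∁ (J s) ∈ F

  ConditionA : Set (lsuc ℓ)
  ConditionA = ∀ (S : Set ℓ) → Infinite S →
               ∀ (J : S → Subset I) → IsPartition J → SomeComplementIn J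

  ConditionB : Set (lsuc ℓ)
  ConditionB = ∀ (J : ℕ → Subset I) → IsPartition J → SomeComplementIn J

  ConditionCAt : ℕ → Set (lsuc ℓ)
  ConditionCAt n =
    ∀ (J : Fin (suc n) → Subset I) → IsPartition J → SomeComplementIn J

  ConditionC : Set (lsuc ℓ)
  ConditionC = ∃ ConditionCAt

  ConditionD : Set (lsuc (lsuc ℓ))
  ConditionD = ∃ (IsFiniteUltrafilterDecomposition F)

IsLeast : ∀ {p} → Pred ℕ p → ℕ → Set p
IsLeast P n = n ∈ P × (∀ m → m ∈ P → n ≤ m)

-- The filter F ↾ A generated by F and A is proper iff ∁ A ∉ F, and an ultrafilter
-- if moreover A is not the union of two disjoint sets with this property.
-- If (c) holds at n but not at n - 1, then the n parts J i of a partition on which it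
-- fails at n - 1 cannot be cut further, so F is the intersection of the n
-- ultrafilters F ↾ J i.  If F is not a finite intersection of ultrafilters, this
-- is inherited by one side of each cut, so infinitely many parts with complement
-- outside F can be cut off one after the other, contradicting (b).
-- Conversely, an ultrafilter contains at most one of several disjoint sets, so
-- the pigeonhole principle gives (a) and (c).  Uniqueness holds since an
-- ultrafilter containing a finite intersection of ultrafilters is one of them.
--
-- Excluded middle decides arbitrary types, not only propositions, and so
-- provides the choices made along the way.
module Submission where

open import Defs
open import Axiom.DoubleNegationElimination using (em⇒dne)
open import Axiom.ExcludedMiddle using (ExcludedMiddle)
open import Data.Empty using (⊥-elim)
open import Data.Fin.Base as Fin using (Fin)
open import Data.Fin.Properties
  using (¬∀⟶∃¬; any?; injective⇒≤; pigeonhole; <⇒≢; ℕ→Fin-notInjective) renaming (_≟_ to _≟ᶠ_)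
open import Data.Nat.Base as ℕ using (ℕ; z≤n)
import Data.Nat.Properties as ℕₚ
open import Data.Product using (Σ-syntax; _×_; _,_; proj₁; proj₂; ∃!)
open import Data.Sum.Base using (_⊎_; inj₁; inj₂)
open import Data.Unit.Polymorphic.Base using (tt)
open import Data.Vec.Functional using (_++_)
open import Data.Vec.Functional.Relation.Unary.All.Properties using (++⁺; ++⁻)
open import Function.Base using (_∘_; id)
open import Function.Bundles using (_⇔_; mk⇔; mk⤖; module Equivalence; module Bijection)
open import Function.Construct.Symmetry using (⤖-sym)
open import Function.Consequences.Propositional using (strictlySurjective⇒surjective)
open import Function.Definitions using (Injective)
open import Level using (Level; suc; Lift; lift; lower)
open import Relation.Binary.Definitions using (tri<; tri≈; tri>)
open import Relation.Binary.PropositionalEquality using (_≡_; _≢_; refl; sym; cong)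
open import Relation.Nullary using (¬_; yes; no; _¬-⊎_)
open import Relation.Nullary.Decidable using (map′)
open import Relation.Unary
  using (Pred; _∈_; _∉_; _⊆_; _≐_; _∩_; _⇒_; _⊥_; ∁; ⋃; ⋂; Universal)
open import Relation.Unary.Polymorphic using (U)
open import Relation.Unary.Properties using (≐-refl; ≐-sym; ≐-trans)

open Equivalence using (to; from)
open IsFilter
open IsUltrafilter
open IsPartition

-- Generating a filter from a filter and a set

module _ {ℓ : Level} {I : Set ℓ} where

  -- A set `K` contains `A ∩ L` for some `L ∈ F` exactly when `A ⇒ K`, the largest such `L`, is in
  -- `F`.
  _↾_ : Family I → Subset I → Family I
  (F ↾ A) K = (A ⇒ K) ∈ F

  ↾-isFilter : ∀ {F : Family I} → IsFilter F → ∀ A → IsFilter (F ↾ A)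
  ↾-isFilter hF A .whole              = hF .upward U _ (hF .whole) λ _ _ → tt
  ↾-isFilter hF A .upward J K j J⊆K   = hF .upward (A ⇒ J) (A ⇒ K) j λ h a → J⊆K (h a)
  ↾-isFilter hF A .inter J K j k      =
    hF .upward ((A ⇒ J) ∩ (A ⇒ K)) _ (hF .inter (A ⇒ J) (A ⇒ K) j k) λ (f , g) a → f a , g a

  ↾-proper : ∀ {F : Family I} → IsFilter F → ∀ A → ∁ A ∉ F → Proper (F ↾ A)
  ↾-proper hF A ∁A∉F univ = ∁A∉F (hF .upward (A ⇒ ∁ A) (∁ A) (univ (∁ A)) λ h a → h a a)

  ⋂-closed : ∀ {F : Family I} → IsFilter F → ∀ n (K : Fin n → Subset I) → (∀ i → K i ∈ F) → ⋂ (Fin n) K ∈ F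
  ⋂-closed hF ℕ.zero    K K∈F = hF .upward U _ (hF .whole) λ _ ()
  ⋂-closed hF (ℕ.suc n) K K∈F =
    hF .upward (K Fin.zero ∩ ⋂ (Fin n) (K ∘ Fin.suc)) _
      (hF .inter (K Fin.zero) _ (K∈F Fin.zero) (⋂-closed hF n (K ∘ Fin.suc) (K∈F ∘ Fin.suc)))
      λ { (x , xs) Fin.zero → x ; (x , xs) (Fin.suc i) → xs i }

  disjoint-∉ : ∀ {F : Family I} → IsUltrafilter F → ∀ J K → J ⊥ K → J ∈ F → K ∉ F
  disjoint-∉ hF J K J⊥K j k = hF .proper λ L →
    hF .isFilter .upward (J ∩ K) L (hF .isFilter .inter J K j k) λ x → ⊥-elim (J⊥K x)

  -- Finite intersections of ultrafilters

  record IsUltrafilterIntersection (F : Family I) {n} (𝓤 : Fin n → Family I) : Set (suc ℓ) where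
    field
      ultrafilter  : ∀ i → IsUltrafilter (𝓤 i)
      intersection : F ≐ ⋂ (Fin n) 𝓤

  open IsUltrafilterIntersection

  -- Repetitions in `𝓤` are allowed, so that intersecting two such filters only concatenates their
  -- families.
  FinitelyUltra : Family I → Set (suc ℓ)
  FinitelyUltra F = Σ[ n ∈ ℕ ] Σ[ 𝓤 ∈ (Fin n → Family I) ] IsUltrafilterIntersection F 𝓤

  FinitelyUltra-resp-≐ : ∀ {F G : Family I} → F ≐ G → FinitelyUltra F → FinitelyUltra G
  FinitelyUltra-resp-≐ F≐G (n , 𝓤 , d) =
    n , 𝓤 , record { ultrafilter = d .ultrafilter ; intersection = ≐-trans (≐-sym F≐G) (d .intersection) }

  universal⇒FinitelyUltra : ∀ {F : Family I} → Universal F → FinitelyUltra F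
  universal⇒FinitelyUltra univ =
    0 , (λ ()) , record { ultrafilter = λ () ; intersection = (λ _ ()) , λ {K} _ → univ K }

  ultrafilter⇒FinitelyUltra : ∀ {F : Family I} → IsUltrafilter F → FinitelyUltra F
  ultrafilter⇒FinitelyUltra {F} hF =
    1 , (λ _ → F) , record { ultrafilter = λ _ → hF ; intersection = (λ k _ → k) , λ h → h Fin.zero }

  ∩-FinitelyUltra : ∀ {F G : Family I} → FinitelyUltra F → FinitelyUltra G → FinitelyUltra (F ∩ G)
  ∩-FinitelyUltra (m , 𝓤 , d) (n , 𝓥 , e) = m ℕ.+ n , 𝓤 ++ 𝓥 , record
    { ultrafilter  = ++⁺ IsUltrafilter {xs = 𝓤} {ys = 𝓥} (d .ultrafilter) (e .ultrafilter)
    ; intersection =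
        (λ {K} (f , g) → ++⁺ (λ G → G K) {xs = 𝓤} {ys = 𝓥}
                           (d .intersection .proj₁ f) (e .intersection .proj₁ g))
      , λ {K} h → let (f , g) = ++⁻ (λ G → G K) 𝓤 {ys = 𝓥} h in
                  d .intersection .proj₂ f , e .intersection .proj₂ g
    }

  -- Ultrafilters as prime filters

  module _ (em : ExcludedMiddle (suc ℓ)) where

    em₀ : ExcludedMiddle ℓ
    em₀ = map′ lower (lift {ℓ = suc ℓ}) em

    -- If `F ↾ K` is proper, maximality identifies it with `F`, and it contains `K`. Otherwise it
    -- contains `∁ K`, and `K ⇒ ∁ K` is just `∁ K`.
    ultrafilter-prime : ∀ {F : Family I} → IsUltrafilter F → ∀ K → K ∈ F ⊎ ∁ K ∈ F
    ultrafilter-prime {F} hF K with em {Universal (F ↾ K)}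
    ... | yes univ = inj₂ (hF .isFilter .upward (K ⇒ ∁ K) (∁ K) (univ (∁ K)) λ h k → h k k)
    ... | no proper↾ =
      inj₁ (hF .maximal (F ↾ K) (↾-isFilter (hF .isFilter) K) proper↾
             (λ {L} l → hF .isFilter .upward L (K ⇒ L) l λ x _ → x)
             .proj₁ {K} (hF .isFilter .upward U (K ⇒ K) (hF .isFilter .whole) λ _ → id))

    -- A set of `G` outside `F` would have its complement in `F ⊆ G`, making `G` improper.
    prime⇒ultrafilter : ∀ {F : Family I} → IsFilter F → Proper F → (∀ K → K ∈ F ⊎ ∁ K ∈ F) → IsUltrafilter F
    prime⇒ultrafilter hF pF prime .isFilter = hF
    prime⇒ultrafilter hF pF prime .proper   = pF
    prime⇒ultrafilter {F} hF pF prime .maximal G hG pG F⊆G = G⊆F , F⊆G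
      where
      G⊆F : G ⊆ F
      G⊆F {K} k with prime K
      ... | inj₁ K∈F  = K∈F
      ... | inj₂ ∁K∈F = ⊥-elim (pG λ L →
        hG .upward (K ∩ ∁ K) L (hG .inter K (∁ K) k (F⊆G ∁K∈F)) λ (x , ¬x) → ⊥-elim (¬x x))

    -- The last hypothesis is primeness of `F ↾ A` in disguise: `∁ (A ∩ K)` amounts to `A ⇒ ∁ K`,
    -- and `∁ (A ∩ ∁ K)` to `A ⇒ K`.
    uncuttable⇒↾-ultrafilter : ∀ {F : Family I} → IsFilter F → ∀ A → ∁ A ∉ F →
                               (∀ K → ∁ (A ∩ K) ∈ F ⊎ ∁ (A ∩ ∁ K) ∈ F) → IsUltrafilter (F ↾ A)
    uncuttable⇒↾-ultrafilter {F} hF A ∁A∉F uncut =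
      prime⇒ultrafilter (↾-isFilter hF A) (↾-proper hF A ∁A∉F) prime
      where
      prime : ∀ K → K ∈ F ↾ A ⊎ ∁ K ∈ F ↾ A
      prime K with uncut K
      ... | inj₁ p = inj₂ (hF .upward (∁ (A ∩ K)) (A ⇒ ∁ K) p λ h a k → h (a , k))
      ... | inj₂ p = inj₁ (hF .upward (∁ (A ∩ ∁ K)) (A ⇒ K) p λ h a → em⇒dne em₀ λ ¬k → h (a , ¬k))

    -- If no `𝓤 i` lies in `V`, pick `K i` in `𝓤 i` but not in `V`. The union of the `K i` is in
    -- every `𝓤 i`, hence in `V`; but so is the intersection of their complements.
    ultrafilter⊇⋂ : ∀ {F n} {𝓤 : Fin n → Family I} → IsUltrafilterIntersection F 𝓤 →
                    ∀ {V} → IsUltrafilter V → F ⊆ V → Σ[ i ∈ Fin n ] V ≐ 𝓤 i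
    ultrafilter⊇⋂ {F} {n} {𝓤} d {V} hV F⊆V with any? (λ i → em {𝓤 i ⊆ V})
    ... | yes (i , 𝓤i⊆V) = i , d .ultrafilter i .maximal V (hV .isFilter) (hV .proper) 𝓤i⊆V
    ... | no  none       = ⊥-elim
      (disjoint-∉ hV (⋃ (Fin n) K) (⋂ (Fin n) (∁ ∘ K)) (λ ((i , k) , h) → h i k) ⋃K∈V ⋂∁K∈V)
      where
      witness : ∀ i → Σ[ K ∈ Subset I ] K ∈ 𝓤 i × K ∉ V
      witness i = em⇒dne em λ ¬w → none (i , λ {K} k → em⇒dne em₀ λ K∉V → ¬w (K , k , K∉V))
      K : Fin n → Subset I
      K = proj₁ ∘ witness
      ∁K∈V : ∀ i → ∁ (K i) ∈ V
      ∁K∈V i with ultrafilter-prime hV (K i)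
      ... | inj₁ k = ⊥-elim (witness i .proj₂ .proj₂ k)
      ... | inj₂ h = h
      ⋂∁K∈V : ⋂ (Fin n) (∁ ∘ K) ∈ V
      ⋂∁K∈V = ⋂-closed (hV .isFilter) n (∁ ∘ K) ∁K∈V
      ⋃K∈V : ⋃ (Fin n) K ∈ V
      ⋃K∈V = F⊆V (d .intersection .proj₂ λ i →
        d .ultrafilter i .isFilter .upward (K i) (⋃ (Fin n) K) (witness i .proj₂ .proj₁) (i ,_))

    -- If no complement is in `F`, each `J m` belongs to some `𝓤 i`, so two of the `n + 1` disjoint
    -- sets share one of `n` ultrafilters. Assuming disjointness alone makes this applicable to
    -- subfamilies of a partition.
    disjoint-someComplement : ∀ {F n} {𝓤 : Fin n → Family I} → IsUltrafilterIntersection F 𝓤 →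
                              (J : Fin (ℕ.suc n) → Subset I) → (∀ i j → i ≢ j → J i ⊥ J j) →
                              SomeComplementIn F J
    disjoint-someComplement {F} {n} {𝓤} d J J-disjoint = em⇒dne em₀ λ none →
      let
        hit : ∀ m → Σ[ i ∈ Fin n ] J m ∈ 𝓤 i
        hit m =
          let i , ∁J∉𝓤i = ¬∀⟶∃¬ n (λ i → ∁ (J m) ∈ 𝓤 i) (λ _ → em₀)
                            (λ h → none (m , d .intersection .proj₂ h))
          in i , em⇒dne em₀ λ J∉𝓤i → (J∉𝓤i ¬-⊎ ∁J∉𝓤i) (ultrafilter-prime (d .ultrafilter i) (J m))
        k , l , k<l , eq = pigeonhole (ℕₚ.n<1+n n) (proj₁ ∘ hit)
      in clash (J-disjoint k l (<⇒≢ k<l)) (hit k) (hit l) eq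
      where
      -- With the two hits as variables, the equality of their indices can be matched with `refl`.
      clash : ∀ {K L : Subset I} → K ⊥ L → (p : Σ[ i ∈ Fin n ] K ∈ 𝓤 i) (q : Σ[ i ∈ Fin n ] L ∈ 𝓤 i) →
              proj₁ p ≢ proj₁ q
      clash {K} {L} K⊥L (i , k) (.i , l) refl = disjoint-∉ (d .ultrafilter i) K L K⊥L k l

    -- An injection from `Fin n` that misses no element would be a bijection onto `S`, so there is
    -- always a value left to extend it.
    infinite⇒injection : ∀ {S : Set ℓ} → Infinite S → ∀ n → Σ[ f ∈ (Fin n → S) ] Injective _≡_ _≡_ f
    infinite⇒injection         S-inf ℕ.zero    = (λ ()) , λ { {()} }
    infinite⇒injection {S = S} S-inf (ℕ.suc n) with infinite⇒injection S-inf n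
    ... | f , f-inj = g , g-inj
      where
      missed : Σ[ s ∈ S ] (∀ i → f i ≢ s)
      missed = em⇒dne em₀ λ none → S-inf (n , mk⤖ (f-inj , strictlySurjective⇒surjective λ s →
        em⇒dne em₀ λ ¬hit → none (s , λ i eq → ¬hit (i , eq))))
      g : Fin (ℕ.suc n) → S
      g Fin.zero    = proj₁ missed
      g (Fin.suc i) = f i
      g-inj : Injective _≡_ _≡_ g
      g-inj {Fin.zero}  {Fin.zero}  eq = refl
      g-inj {Fin.zero}  {Fin.suc j} eq = ⊥-elim (proj₂ missed j (sym eq))
      g-inj {Fin.suc i} {Fin.zero}  eq = ⊥-elim (proj₂ missed i eq)
      g-inj {Fin.suc i} {Fin.suc j} eq = cong Fin.suc (f-inj eq)

    -- Cutting off parts: from (b) to finitely many ultrafilters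

    module _ {F : Family I} (hF : IsFilter F) where

      ↾-cut : ∀ A K → (F ↾ (A ∩ K)) ∩ (F ↾ (A ∩ ∁ K)) ≐ F ↾ A
      ↾-cut A K .proj₁ {L} (l₁ , l₂) =
        hF .upward (((A ∩ K) ⇒ L) ∩ ((A ∩ ∁ K) ⇒ L)) (A ⇒ L)
          (hF .inter ((A ∩ K) ⇒ L) ((A ∩ ∁ K) ⇒ L) l₁ l₂) glue
        where
        glue : ((A ∩ K) ⇒ L) ∩ ((A ∩ ∁ K) ⇒ L) ⊆ (A ⇒ L)
        glue {x} (f , g) a with em₀ {K x}
        ... | yes k = f (a , k)
        ... | no ¬k = g (a , ¬k)
      ↾-cut A K .proj₂ {L} l =
          hF .upward (A ⇒ L) ((A ∩ K) ⇒ L) l (λ h (a , _) → h a)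
        , hF .upward (A ⇒ L) ((A ∩ ∁ K) ⇒ L) l (λ h (a , _) → h a)

      -- The part `A ∩ ∁ C` is cut off and `A ∩ C` is kept. Without such a `C`, either `F ↾ A` is
      -- improper, or some cut has two sides with complement outside `F`, both then finitely
      -- decomposable, or `A` is uncuttable and `F ↾ A` an ultrafilter.
      cut : ∀ A → ¬ FinitelyUltra (F ↾ A) →
            Σ[ C ∈ Subset I ] ∁ (A ∩ ∁ C) ∉ F × ¬ FinitelyUltra (F ↾ (A ∩ C))
      cut A ¬fin = em⇒dne em λ none → ¬fin (finite none)
        where
        module _ (none : ¬ (Σ[ C ∈ Subset I ] ∁ (A ∩ ∁ C) ∉ F × ¬ FinitelyUltra (F ↾ (A ∩ C)))) where
          finite : FinitelyUltra (F ↾ A)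
          finite with em₀ {∁ A ∈ F}
          ... | yes ∁A∈F = universal⇒FinitelyUltra λ K →
            hF .upward (∁ A) (A ⇒ K) ∁A∈F λ ¬a a → ⊥-elim (¬a a)
          ... | no ∁A∉F with em {Σ[ K ∈ Subset I ] ∁ (A ∩ K) ∉ F × ∁ (A ∩ ∁ K) ∉ F}
          ...   | yes (K , ∁AK∉F , ∁A∁K∉F) = FinitelyUltra-resp-≐ (↾-cut A K)
            (∩-FinitelyUltra
              (em⇒dne em λ ¬fin₁ → none (K , ∁A∁K∉F , ¬fin₁))
              -- Keeping `∁ K` cuts off `A ∩ ∁ (∁ K)`, which contains `A ∩ K`.
              (em⇒dne em λ ¬fin₂ → none (∁ K ,
                (λ p → ∁AK∉F (hF .upward (∁ (A ∩ ∁ (∁ K))) (∁ (A ∩ K)) p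
                               λ h (a , k) → h (a , λ ¬k → ¬k k))) , ¬fin₂)))
          ...   | no uncut = ultrafilter⇒FinitelyUltra (uncuttable⇒↾-ultrafilter hF A ∁A∉F uncut′)
            where
            uncut′ : ∀ K → ∁ (A ∩ K) ∈ F ⊎ ∁ (A ∩ ∁ K) ∈ F
            uncut′ K with em₀ {∁ (A ∩ K) ∈ F}
            ... | yes p = inj₁ p
            ... | no ¬p = inj₂ (em⇒dne em₀ λ ¬q → uncut (K , ¬p , ¬q))

      -- The points outside all of the P (suc m) are added to P 0.
      B⇒disjoint-someComplement : ConditionB F → (P : ℕ → Subset I) →
                                  (∀ m n → m ≢ n → P m ⊥ P n) → SomeComplementIn F P
      B⇒disjoint-someComplement condB P P-disjoint with condB J J-partition
        where
        J : ℕ → Subset I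
        J ℕ.zero    = ∁ (⋃ ℕ (P ∘ ℕ.suc))
        J (ℕ.suc m) = P (ℕ.suc m)
        J-partition : IsPartition J
        J-partition .covers x with em₀ {⋃ ℕ (P ∘ ℕ.suc) x}
        ... | yes (m , p) = ℕ.suc m , p
        ... | no ¬p       = 0 , ¬p
        J-partition .disjoint ℕ.zero    ℕ.zero    0≢0 = ⊥-elim (0≢0 refl)
        J-partition .disjoint ℕ.zero    (ℕ.suc n) _   = λ (¬p , p) → ¬p (n , p)
        J-partition .disjoint (ℕ.suc m) ℕ.zero    _   = λ (p , ¬p) → ¬p (m , p)
        J-partition .disjoint (ℕ.suc m) (ℕ.suc n) m≢n = P-disjoint (ℕ.suc m) (ℕ.suc n) m≢n
      ... | ℕ.suc m , p = ℕ.suc m , p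
      ... | ℕ.zero  , p = 0 , hF .upward (∁ (∁ (⋃ ℕ (P ∘ ℕ.suc)))) (∁ (P 0)) p
        λ h x∈P₀ → h λ (m , x∈Pₘ) → P-disjoint 0 (ℕ.suc m) (λ ()) (x∈P₀ , x∈Pₘ)

      B⇒FinitelyUltra : ConditionB F → FinitelyUltra F
      B⇒FinitelyUltra condB = em⇒dne em λ ¬fin →
        let
          start : Stage
          start = U , λ fin → ¬fin (FinitelyUltra-resp-≐ ↾-whole fin)
          m , ∁P∈F = B⇒disjoint-someComplement condB (piece start) (piece-disjoint start)
        in cut-off (stage start m) .proj₂ .proj₁ ∁P∈F
        where
        Stage : Set (suc ℓ)
        Stage = Σ[ A ∈ Subset I ] ¬ FinitelyUltra (F ↾ A)

        ↾-whole : F ↾ U ≐ F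
        ↾-whole = (λ {K} k → hF .upward (U ⇒ K) K k λ h → h tt)
                , (λ {K} k → hF .upward K (U ⇒ K) k λ x _ → x)

        cut-off : ((A , _) : Stage) →
                  Σ[ C ∈ Subset I ] ∁ (A ∩ ∁ C) ∉ F × ¬ FinitelyUltra (F ↾ (A ∩ C))
        cut-off (A , ¬fin) = cut A ¬fin

        module _ (start : Stage) where
          -- The set in `stage m` is what remains after `m` cuts; its proof of not being finitely
          -- decomposable permits the next cut.
          stage : ℕ → Stage
          stage ℕ.zero    = start
          stage (ℕ.suc m) = let (A , _) = stage m ; (C , _ , ¬fin) = cut-off (stage m) in A ∩ C , ¬fin

          C : ℕ → Subset I
          C m = cut-off (stage m) .proj₁

          piece : ℕ → Subset I
          piece m = stage m .proj₁ ∩ ∁ (C m)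

          -- Every stage after `m` lies inside `C m`, whereas `piece m` lies outside. The order `<′`
          -- grows at its upper end, as `stage` does.
          stage⊆C : ∀ {m n} → m ℕ.<′ n → stage n .proj₁ ⊆ C m
          stage⊆C (ℕ.<′-base)     (_ , c) = c
          stage⊆C (ℕ.<′-step m<n) (a , _) = stage⊆C m<n a

          piece-disjoint : ∀ m n → m ≢ n → piece m ⊥ piece n
          piece-disjoint m n m≢n ((a , ¬c) , (a′ , ¬c′)) with ℕₚ.<-cmp m n
          ... | tri< m<n _ _ = ¬c (stage⊆C (ℕₚ.<⇒<′ m<n) a′)
          ... | tri≈ _ m≡n _ = m≢n m≡n
          ... | tri> _ _ n<m = ¬c′ (stage⊆C (ℕₚ.<⇒<′ n<m) a)

      -- From (c) to distinct ultrafilters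

      partition-uncuttable : ∀ {m} → ConditionCAt F (ℕ.suc m) →
                             (J : Fin (ℕ.suc m) → Subset I) → IsPartition J → ¬ SomeComplementIn F J →
                             ∀ i K → ∁ (J i ∩ K) ∈ F ⊎ ∁ (J i ∩ ∁ K) ∈ F
      partition-uncuttable {m} condC J hJ none i K with condC J′ J′-partition
        where
        -- The part `J i` is split into `J i ∩ K`, at index zero, and `J i ∩ ∁ K`, at `suc i`; the
        -- other parts are unchanged. Since `none` excludes the latter, `condC` must select one of
        -- the two halves.
        J′ : Fin (ℕ.suc (ℕ.suc m)) → Subset I
        J′ Fin.zero    = J i ∩ K
        J′ (Fin.suc j) = λ x → J j x × (j ≡ i → ¬ K x)

        zero⊥suc : ∀ j → J′ Fin.zero ⊥ J′ (Fin.suc j)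
        zero⊥suc j ((xi , k) , (xj , ¬k)) with j ≟ᶠ i
        ... | yes j≡i = ¬k j≡i k
        ... | no  j≢i = hJ .disjoint j i j≢i (xj , xi)

        J′-partition : IsPartition J′
        J′-partition .covers x with hJ .covers x
        ... | j , xj with j ≟ᶠ i
        ...   | no  j≢i = Fin.suc j , xj , λ j≡i → ⊥-elim (j≢i j≡i)
        ...   | yes refl with em₀ {K x}
        ...     | yes k = Fin.zero , xj , k
        ...     | no ¬k = Fin.suc j , xj , λ _ → ¬k
        J′-partition .disjoint Fin.zero    Fin.zero    0≢0 = ⊥-elim (0≢0 refl)
        J′-partition .disjoint Fin.zero    (Fin.suc k) _   = zero⊥suc k
        J′-partition .disjoint (Fin.suc j) Fin.zero    _   = λ (p , q) → zero⊥suc j (q , p)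
        J′-partition .disjoint (Fin.suc j) (Fin.suc k) j≢k =
          λ ((xj , _) , (xk , _)) → hJ .disjoint j k (j≢k ∘ cong Fin.suc) (xj , xk)
      ... | Fin.zero , p = inj₁ p
      ... | Fin.suc j , p with j ≟ᶠ i
      ...   | yes refl = inj₂ (hF .upward _ (∁ (J i ∩ ∁ K)) p λ h (x , ¬k) → h (x , λ _ → ¬k))
      ...   | no  j≢i  = ⊥-elim (none (j , hF .upward _ (∁ (J j)) p
                           λ h x → h (x , λ j≡i → ⊥-elim (j≢i j≡i))))

      -- Descend from `m` until (c) fails one step lower; a partition witnessing the failure yields
      -- the ultrafilters. If the descent reaches zero, the one-part partition puts `∁ U` in `F`,
      -- and the empty family serves. The bound `n ≤ m` is kept for the minimality claim.
      CAt⇒ultrafilters : ∀ m → ConditionCAt F m →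
                         Σ[ n ∈ ℕ ] n ℕ.≤ m × Σ[ 𝓤 ∈ (Fin n → Family I) ]
                           IsUltrafilterIntersection F 𝓤 × Injective _≡_ _≐_ 𝓤
      CAt⇒ultrafilters ℕ.zero condC with condC (λ _ → U) trivial
        where
        trivial : IsPartition {S = Fin 1} (λ _ → U {A = I})
        trivial .covers x = Fin.zero , tt
        trivial .disjoint Fin.zero Fin.zero 0≢0 = ⊥-elim (0≢0 refl)
      ... | _ , ∁U∈F = 0 , z≤n , (λ ()) , record
        { ultrafilter  = λ ()
        ; intersection = (λ _ ()) , λ {K} _ → hF .upward _ K ∁U∈F λ h → ⊥-elim (h tt)
        } , λ { {()} }
      CAt⇒ultrafilters (ℕ.suc m) condC with em {ConditionCAt F m}
      ... | yes condC′ =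
        let n , n≤m , 𝓤 , d = CAt⇒ultrafilters m condC′ in n , ℕₚ.m≤n⇒m≤1+n n≤m , 𝓤 , d
      ... | no ¬condC′ = ℕ.suc m , ℕₚ.≤-refl , 𝓤 , record
        { ultrafilter  = 𝓤-ultrafilter
        ; intersection = (λ {K} k i → hF .upward K (J i ⇒ K) k λ x _ → x)
                       -- As the `J i` cover `I`, the intersection of all `J i ⇒ K` lies inside `K`.
                       , λ {K} k → hF .upward (⋂ _ λ i → J i ⇒ K) K
                           (⋂-closed hF _ (λ i → J i ⇒ K) k)
                           λ {x} h → let i , xi = hJ .covers x in h i xi
        } , distinct
        where
        -- Condition (c) at `m` concerns `m + 1` parts, so its failure there gives `m + 1`
        -- ultrafilters.
        bad : Σ[ J ∈ (Fin (ℕ.suc m) → Subset I) ] IsPartition J × ¬ SomeComplementIn F J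
        bad = em⇒dne em λ none → ¬condC′ λ J hJ → em⇒dne em₀ λ ¬s → none (J , hJ , ¬s)
        J = proj₁ bad
        hJ = proj₁ (proj₂ bad)
        J-none = proj₂ (proj₂ bad)
        𝓤 : Fin (ℕ.suc m) → Family I
        𝓤 i = F ↾ J i
        𝓤-ultrafilter : ∀ i → IsUltrafilter (𝓤 i)
        𝓤-ultrafilter i = uncuttable⇒↾-ultrafilter hF (J i) (λ p → J-none (i , p))
                            (partition-uncuttable condC J hJ J-none i)
        Ji∈𝓤i : ∀ i → J i ∈ 𝓤 i
        Ji∈𝓤i i = hF .upward U (J i ⇒ J i) (hF .whole) λ _ → id
        distinct : Injective _≡_ _≐_ 𝓤
        distinct {i} {j} (_ , 𝓤j⊆𝓤i) with i ≟ᶠ j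
        ... | yes i≡j = i≡j
        ... | no  i≢j = ⊥-elim (disjoint-∉ (𝓤-ultrafilter i) (J i) (J j) (hJ .disjoint i j i≢j)
                          (Ji∈𝓤i i) (𝓤j⊆𝓤i {J j} (Ji∈𝓤i j)))

      -- The set of ultrafilters is closed under `≐`, as `members` demands; hence being an
      -- ultrafilter has to be transported along `≐`.
      C⇒D : ConditionC F → ConditionD F
      C⇒D (m , condC) with CAt⇒ultrafilters m condC
      ... | n , _ , 𝓤 , d , 𝓤-distinct = (λ G → Σ[ i ∈ Fin n ] G ≐ 𝓤 i) , record
        { finite       = n , record { enum = 𝓤 ; distinct = 𝓤-distinct ; members = λ G → mk⇔ id id }
        ; ultrafilters = λ G (i , G≐𝓤i) → ultrafilter-resp G≐𝓤i (d .ultrafilter i)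
        ; intersection = (λ k (G , i , G≐𝓤i) → G≐𝓤i .proj₂ (d .intersection .proj₁ k i))
                       , λ h → d .intersection .proj₂ λ i → h (𝓤 i , i , ≐-refl)
        }
        where
        ultrafilter-resp : ∀ {G V} → G ≐ V → IsUltrafilter V → IsUltrafilter G
        ultrafilter-resp (G⊆V , V⊆G) hV = record
          { isFilter = record
            { whole  = V⊆G (hV .isFilter .whole)
            ; upward = λ J K j J⊆K → V⊆G (hV .isFilter .upward J K (G⊆V j) J⊆K)
            ; inter  = λ J K j k → V⊆G (hV .isFilter .inter J K (G⊆V j) (G⊆V k))
            }
          ; proper   = λ univ → hV .proper λ K → G⊆V (univ K)
          ; maximal  = λ H hH pH G⊆H →
              ≐-trans (hV .maximal H hH pH (λ k → G⊆H (V⊆G k))) (V⊆G , G⊆V)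
          }

    -- Uniqueness and cardinality of the decomposition

    module _ {F : Family I} {𝒰 : Pred (Family I) (suc ℓ)}
             (D : IsFiniteUltrafilterDecomposition F 𝒰) where
      private
        module D = IsFiniteUltrafilterDecomposition D

      open HasCardinality (D.finite .proj₂)

      enum∈ : ∀ i → enum i ∈ 𝒰
      enum∈ i = members (enum i) .from (i , ≐-refl)

      enum-intersection : IsUltrafilterIntersection F enum
      enum-intersection = record
        { ultrafilter  = λ i → D.ultrafilters (enum i) (enum∈ i)
        ; intersection = (λ k i → D.intersection .proj₁ k (enum i , enum∈ i))
                       , λ h → D.intersection .proj₂ λ (G , G∈𝒰) →
                           let i , G≐ = members G .to G∈𝒰 in G≐ .proj₂ (h i)
        }

      -- The right-hand side depends on `F` alone, so any two decompositions agree.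
      decomposition≐ : 𝒰 ≐ (λ G → IsUltrafilter G × F ⊆ G)
      decomposition≐ .proj₁ {G} G∈𝒰 =
        D.ultrafilters G G∈𝒰 , λ k → D.intersection .proj₁ k (G , G∈𝒰)
      decomposition≐ .proj₂ {G} (hG , F⊆G) =
        members G .from (ultrafilter⊇⋂ enum-intersection hG F⊆G)

      decomposition-CAt : ConditionCAt F (D.finite .proj₁)
      decomposition-CAt J hJ = disjoint-someComplement enum-intersection J (hJ .disjoint)

      -- If (c) holds at `m`, then `F` is an intersection of `n ≤ m` ultrafilters. Each `enum i`
      -- contains `F`, so it is one of these, and distinct members of `enum` match distinct indices.
      decomposition-least : IsFilter F → IsLeast (ConditionCAt F) (D.finite .proj₁)
      decomposition-least hF = decomposition-CAt , λ m condC →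
        let n , n≤m , 𝓤 , d , _ = CAt⇒ultrafilters hF m condC
            match : ∀ i → Σ[ j ∈ Fin n ] enum i ≐ 𝓤 j
            match i = ultrafilter⊇⋂ d (D.ultrafilters (enum i) (enum∈ i))
                        (λ k → enum-intersection .intersection .proj₁ k i)
            match-injective : Injective _≡_ _≡_ (proj₁ ∘ match)
            match-injective {i} {j} eq = distinct (glue (match i) (match j) eq)
        in ℕₚ.≤-trans (injective⇒≤ match-injective) n≤m
        where
        glue : ∀ {n} {𝓤 : Fin n → Family I} {G H : Family I} →
               (p : Σ[ i ∈ Fin n ] G ≐ 𝓤 i) (q : Σ[ i ∈ Fin n ] H ≐ 𝓤 i) → proj₁ p ≡ proj₁ q → G ≐ H
        glue (i , G≐) (.i , H≐) refl = ≐-trans G≐ (≐-sym H≐)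

    -- From finite decompositions to (a) and (c), and from (a) to (b)

    FinitelyUltra⇒A : ∀ {F : Family I} → FinitelyUltra F → ConditionA F
    FinitelyUltra⇒A (n , 𝓤 , d) S S-inf J hJ =
      -- Among `n` ultrafilters, `n + 1` distinct parts suffice for the pigeonhole argument.
      let f , f-inj = infinite⇒injection S-inf (ℕ.suc n)
          i , p = disjoint-someComplement d (J ∘ f) λ i j i≢j → hJ .disjoint (f i) (f j) (i≢j ∘ f-inj)
      in f i , p

    FinitelyUltra⇒C : ∀ {F : Family I} → FinitelyUltra F → ConditionC F
    FinitelyUltra⇒C (n , 𝓤 , d) = n , λ J hJ → disjoint-someComplement d J (hJ .disjoint)

  -- Condition (a) ranges over index sets of level `ℓ`, so `ℕ` is lifted to that level.
  A⇒B : ∀ {F : Family I} → ConditionA F → ConditionB F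
  A⇒B condA J hJ =
    let lift m , p = condA (Lift ℓ ℕ) ℕ-infinite (J ∘ lower) J′-partition in m , p
    where
    ℕ-infinite : Infinite (Lift ℓ ℕ)
    ℕ-infinite (n , f) =
      ℕ→Fin-notInjective (Bijection.to (⤖-sym f) ∘ lift) (cong lower ∘ Bijection.injective (⤖-sym f))
    J′-partition : IsPartition (J ∘ lower {ℓ = ℓ})
    J′-partition .covers x = let m , p = hJ .covers x in lift m , p
    J′-partition .disjoint (lift m) (lift n) m≢n = hJ .disjoint m n (m≢n ∘ cong lift)

lemma3 : ∀ {ℓ : Level} → ExcludedMiddle (suc ℓ) →
    ∀ (I : Set ℓ) (F : Family I) → IsFilter F →
    ((ConditionA F ⇔ ConditionB F) ×
    (ConditionB F ⇔ ConditionC F) ×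
    (ConditionC F ⇔ ConditionD F)) ×
    (ConditionD F →
    ∃! _≐_ (IsFiniteUltrafilterDecomposition F) ×
    (∀ (𝒰 : Pred (Family I) (suc ℓ)) →
    IsFiniteUltrafilterDecomposition F 𝒰 →
    Σ[ n ∈ ℕ ] HasCardinality 𝒰 n × IsLeast (ConditionCAt F) n))
lemma3 em I F hF =
    ( mk⇔ (A⇒B {F = F}) (FinitelyUltra⇒A em ∘ B⇒FinitelyUltra em hF)
    , mk⇔ (FinitelyUltra⇒C em ∘ B⇒FinitelyUltra em hF) (A⇒B {F = F} ∘ FinitelyUltra⇒A em ∘ C⇒FinitelyUltra)
    , mk⇔ (C⇒D em hF) (λ (_ , D) → _ , decomposition-CAt em D)
    )
  , λ (𝒰 , D) →
      (𝒰 , D , λ D′ → ≐-trans (decomposition≐ em D) (≐-sym (decomposition≐ em D′)))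
    , λ 𝒱 D′ → let n , card = IsFiniteUltrafilterDecomposition.finite D′ in
               n , card , decomposition-least em D′ hF
  where
  C⇒FinitelyUltra : ConditionC F → FinitelyUltra F
  C⇒FinitelyUltra (m , condC) =
    let n , _ , 𝓤 , d , _ = CAt⇒ultrafilters em hF m condC in n , 𝓤 , d
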